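{- Let $G$ be a $3$-connected graph. If $\sigma_2(G)\ge 2\widetilde{\alpha}(G)+1$, then $G$ is hamiltonian-connected, i.e., for every two distinct vertices $x,y$ of $G$ there is a path from $x$ to $y$ containing every vertex of $G$.
   Context: All graphs are finite and simple. For a graph $G$ that is not complete, $\sigma_2(G)=\min\{d_G(u)+d_G(v): u,v\in V(G),\ u\ne v,\ uv\notin E(G)\}$; if $G$ is complete, $\sigma_2(G)=\infty$. An $(s,t)$-bipartite-hole in $G$ consists of two disjoint vertex sets $S,T\subseteq V(G)$ with $|S|=s$, $|T|=t$ and no edge of $G$ having one endpoint in $S$ and the other in $T$. The bipartite-hole-number $\widetilde{\alpha}(G)$ is the minimum integer $k$ such that there exist positive integers $s,t$ with $s+t=k+1$ for which $G$ contains no $(s,t)$-bipartite-hole. -}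

module Defs where

open import Data.Fin.Base using (Fin)
open import Data.Fin.Properties using (_≟_; all?)
open import Data.Fin.Subset using (Subset; _∈_; _∉_; ∣_∣; _∩_; Empty)
open import Data.Fin.Subset.Properties using (_∈?_; ∣p∣≤n; anySubset?; nonempty?)
open import Data.List.Base using (List; []; _∷_; map; filter; cartesianProduct; allFin)
import Data.List.Membership.Propositional as List
open import Data.List.Relation.Unary.All using (All)
open import Data.List.Relation.Unary.Unique.Propositional using (Unique)
import Data.List.Extrema as Extrema
open import Data.Nat.Base using (ℕ; zero; suc; _+_; _≤_; _<_; z≤n; s≤s)
import Data.Nat.Properties as ℕ
open import Data.Product.Base using (Σ; ∃; ∃₂; _×_; _,_; proj₁; uncurry)
open import Data.Vec.Base using (tabulate)
open import Function.Base using (_∘_)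
open import Level using (0ℓ)
open import Relation.Binary.Bundles using (TotalOrder)
open import Relation.Binary.Core using (Rel)
open import Relation.Binary.Definitions using (Decidable; Irreflexive; Symmetric)
open import Relation.Binary.PropositionalEquality.Core using (_≡_; _≢_; refl; subst)
import Relation.Binary.Construct.Add.Supremum.NonStrict as AddSupremum
open import Relation.Nullary.Construct.Add.Supremum using (_⁺; [_]; ⊤⁺)
open import Relation.Nullary.Decidable
  using (Dec; yes; no; does; map′; ¬?; _×-dec_; _→-dec_)
open import Relation.Nullary.Negation using (¬_; contradiction)
import Relation.Unary as Unary

record Graph (n : ℕ) : Set₁ where
  field
    Adj    : Rel (Fin n) 0ℓ
    adj?   : Decidable Adj
    sym    : Symmetric Adj
    irrefl : Irreflexive _≡_ Adj

module _ {n : ℕ} (G : Graph n) where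
  open Graph G

  data Walk : Fin n → Fin n → Set where
    stop : ∀ u → Walk u u
    step : ∀ u {v w} → Adj u v → Walk v w → Walk u w

  vertices : ∀ {u v} → Walk u v → List (Fin n)
  vertices (stop u)     = u ∷ []
  vertices (step u _ p) = u ∷ vertices p

  IsPath : ∀ {u v} → Walk u v → Set
  IsPath p = Unique (vertices p)

  -- A path of G − X is a path of G none of whose vertices lies in X.
  ConnectedWithout : Subset n → Set
  ConnectedWithout X = ∀ {u v} → u ∉ X → v ∉ X →
    Σ (Walk u v) λ p → IsPath p × All (_∉ X) (vertices p)

  -- With k < n, a set of fewer than k vertices never exhausts the graph, so
  -- every G − X considered here is nonempty.
  KConnected : ℕ → Set
  KConnected k = k < n × (∀ X → ∣ X ∣ < k → ConnectedWithout X)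

  IsHamiltonian : ∀ {u v} → Walk u v → Set
  IsHamiltonian p = IsPath p × (∀ w → w List.∈ vertices p)

  HamiltonianConnected : Set
  HamiltonianConnected = ∀ x y → x ≢ y → Σ (Walk x y) IsHamiltonian

  neighbours : Fin n → Subset n
  neighbours v = tabulate (does ∘ adj? v)

  degree : Fin n → ℕ
  degree v = ∣ neighbours v ∣

  NonAdjacent : Fin n → Fin n → Set
  NonAdjacent u v = u ≢ v × ¬ Adj u v

  nonAdjacent? : Decidable NonAdjacent
  nonAdjacent? u v = ¬? (u ≟ v) ×-dec ¬? (adj? u v)

  nonAdjacentPairs : List (Fin n × Fin n)
  nonAdjacentPairs =
    filter (uncurry nonAdjacent?) (cartesianProduct (allFin n) (allFin n))

open AddSupremum _≤_ public using (_≤⁺_)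

≤⁺-totalOrder : TotalOrder 0ℓ 0ℓ 0ℓ
≤⁺-totalOrder = record
  { isTotalOrder = AddSupremum.≤⁺-isTotalOrder-≡ _≤_ ℕ.≤-isTotalOrder }

open Extrema ≤⁺-totalOrder using (min)

-- The minimum over the empty list is ⊤⁺, so a complete graph has σ₂ = ∞.
σ₂ : ∀ {n} → Graph n → ℕ ⁺
σ₂ G = min ⊤⁺ (map (λ (u , v) → [ degree G u + degree G v ]) (nonAdjacentPairs G))

IsLeast : Unary.Pred ℕ 0ℓ → ℕ → Set
IsLeast P m = P m × (∀ {j} → P j → m ≤ j)

least : ∀ {P : Unary.Pred ℕ 0ℓ} → Unary.Decidable P → ∀ k → P k → ∃ (IsLeast P)
least P? zero p = zero , p , λ _ → z≤n
least {P} P? (suc k) p with P? zero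
... | yes p₀ = zero , p₀ , λ _ → z≤n
... | no ¬p₀ with least (P? ∘ suc) k p
...   | m , pₘ , m≤ = suc m , pₘ , minimal
  where
  minimal : ∀ {j} → P j → suc m ≤ j
  minimal {zero}  q = contradiction q ¬p₀
  minimal {suc j} q = s≤s (m≤ q)

module _ {n : ℕ} (G : Graph n) where
  open Graph G

  IsBipartiteHole : ℕ → ℕ → Subset n → Subset n → Set
  IsBipartiteHole s t S T =
    Empty (S ∩ T) × ∣ S ∣ ≡ s × ∣ T ∣ ≡ t ×
    (∀ u v → u ∈ S → v ∈ T → ¬ Adj u v)

  HasBipartiteHole : ℕ → ℕ → Set
  HasBipartiteHole s t = ∃₂ λ S T → IsBipartiteHole s t S T

  HasHoleFreeSplit : ℕ → Set
  HasHoleFreeSplit k =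
    ∃₂ λ s t → 0 < s × 0 < t × s + t ≡ k + 1 × ¬ HasBipartiteHole s t

  hasBipartiteHole? : Decidable HasBipartiteHole
  hasBipartiteHole? s t = anySubset? λ S → anySubset? λ T →
    ¬? (nonempty? (S ∩ T)) ×-dec (∣ S ∣ ℕ.≟ s) ×-dec (∣ T ∣ ℕ.≟ t) ×-dec
    all? λ u → all? λ v → (u ∈? S) →-dec ((v ∈? T) →-dec ¬? (adj? u v))

  hasHoleFreeSplit? : Unary.Decidable HasHoleFreeSplit
  hasHoleFreeSplit? k = map′
    (λ (s , _ , t , _ , h) → s , t , h)
    (λ (s , t , h@(_ , _ , s+t≡ , _)) →
      s , s≤s (subst (s ≤_) s+t≡ (ℕ.m≤m+n s t)) ,
      t , s≤s (subst (t ≤_) s+t≡ (ℕ.m≤n+m t s)) , h)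
    (ℕ.anyUpTo? (λ s → ℕ.anyUpTo? (λ t →
      (0 ℕ.<? s) ×-dec (0 ℕ.<? t) ×-dec (s + t ℕ.≟ k + 1) ×-dec
      ¬? (hasBipartiteHole? s t))
      (suc (k + 1))) (suc (k + 1)))

  -- No vertex set has n + 1 elements, so s = n + 1, t = 1 is always hole-free.
  holeFreeSplit-exists : ∃ HasHoleFreeSplit
  holeFreeSplit-exists = suc n , suc n , 1 , s≤s z≤n , s≤s z≤n , refl ,
    λ (S , _ , _ , ∣S∣≡ , _) → ℕ.<-irrefl refl (subst (_≤ n) ∣S∣≡ (∣p∣≤n S))

  bipartiteHoleNumber-least : ∃ (IsLeast HasHoleFreeSplit)
  bipartiteHoleNumber-least =
    uncurry (least hasHoleFreeSplit?) holeFreeSplit-exists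

  bipartiteHoleNumber : ℕ
  bipartiteHoleNumber = proj₁ bipartiteHoleNumber-least

{-# OPTIONS --safe #-}

-- Let s + t = α̃(G) + 1 be such that G has no (s,t)-bipartite-hole, and call a vertex big
-- if its degree is at least s + t.  By the bound on σ₂ the small vertices form a clique.
-- Adding all edges between big vertices makes them a clique as well, and a 3-connected
-- graph covered by two cliques is hamiltonian-connected.  The added edges are then removed
-- one by one.  We may take the edge xy to be present.  If a hamiltonian x–y path uses the
-- added edge ab, then replacing ab by xy turns it into a hamiltonian a–b path Q through xy.
-- Let c d and c′ d′ be edges of Q other than xy, in this order along Q.  An edge c d′ when
-- a ~ d, b ~ c′, or an edge c c′ when a ~ d′, b ~ d, closes Q up to a hamiltonian cycle
-- through xy without ab.  Since a and b are big, cutting Q just before or just after the s-th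
-- non-xy edge whose far end is adjacent to a yields two sets of sizes s and t such that any edge
-- between them is of one of these two kinds; as G has no (s,t)-bipartite-hole, there is one.

module Submission where

open import Defs
open import Algebra.Properties.CommutativeSemigroup using (interchange)
open import Data.Bool.Base using (true; false)
open import Data.Fin.Base using (Fin; zero; suc)
open import Data.Fin.Properties using (_≟_; any?; ¬∀⟶∃¬)
open import Data.Fin.Subset using (Subset; inside; outside; _∪_; ⁅_⁆; ∣_∣; ⊥; ⊤)
  renaming (_∈_ to _∈ₛ_; _∉_ to _∉ₛ_)
open import Data.Fin.Subset.Properties
  using (p⊆q⇒∣p∣≤∣q∣; x∈p∪q⁺; x∈p∪q⁻; x∈⁅x⁆; x∈⁅y⁆⇒x≡y; ∉⊥; ∣⊥∣≡0; ∣⊤∣≡n; ∪-identityˡ; x∈p∩q⁻)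
open import Data.List.Base
  using (List; []; _∷_; _++_; _∷ʳ_; map; filter; length; take; foldr; allFin; cartesianProduct)
open import Data.List.Extrema ≤⁺-totalOrder using (min≤v⁺)
open import Data.List.Membership.Propositional using (_∈_; _∉_; find; lose)
open import Data.List.Membership.Propositional.Properties
import Data.List.Properties as List
open import Data.List.Properties
  using (++-assoc; length-++; length-map; length-take; take++drop≡id; map-++;
         filter-++; filter-accept; filter-reject; filter-none)
open import Data.List.Relation.Binary.Disjoint.Propositional using (Disjoint)
open import Data.List.Relation.Binary.Permutation.Propositional
  using (_↭_; ↭⇒↭ₛ; ↭-refl; ↭-trans; ↭-sym; ↭-reflexive)
open import Data.List.Relation.Binary.Permutation.Propositional.Properties
  using (++⁺; ++⁺ˡ; ++-comm; ∷↭∷ʳ; ∈-resp-↭)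
open import Data.List.Relation.Binary.Permutation.Setoid.Properties using (Unique-resp-↭)
open import Data.List.Relation.Unary.All as All using (All; []; _∷_)
import Data.List.Relation.Unary.All.Properties as All
open import Data.List.Relation.Unary.AllPairs using ([]; _∷_)
import Data.List.Relation.Unary.AllPairs.Properties as AllPairs
open import Data.List.Relation.Unary.Any as Any using (here; there)
open import Data.List.Relation.Unary.Unique.Propositional using (Unique)
import Data.List.Relation.Unary.Unique.Propositional.Properties as Unique
open import Data.Nat.Base
  using (ℕ; zero; suc; _+_; _*_; _≤_; _<_; z≤n; s≤s; s≤s⁻¹; s<s⁻¹)
open import Data.Nat.Properties hiding (_≟_)
open import Data.Product.Base using (Σ; ∃; ∃₂; _×_; _,_; proj₁; proj₂; swap)
open import Data.Sum.Base as Sum using (_⊎_; inj₁; inj₂; [_,_]′; reduce)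
open import Data.Unit.Base using (tt)
import Data.Vec.Base as Vec
open import Data.Vec.Base using (_∷_)
import Data.Vec.Properties as Vec
open import Function.Base using (_∘_; id)
open import Level using (0ℓ)
open import Relation.Binary.Bundles using (TotalOrder)
open import Relation.Binary.Construct.Add.Supremum.NonStrict using ([≤]-injective)
open import Relation.Binary.PropositionalEquality
  using (_≡_; _≢_; refl; sym; trans; cong; cong₂; subst; setoid; ≢-sym)
open import Relation.Nullary.Construct.Add.Supremum as Sup using ([_])
open import Relation.Nullary.Decidable
  using (Dec; yes; no; does; dec-true; toSum; ¬?; _×-dec_; _⊎-dec_; decidable-stable)
open import Relation.Nullary.Negation using (¬_; contradiction)
open import Relation.Unary using (Pred; Decidable; U)

-- Lists without repetition, and counting entries.

Unique-++⁻ : ∀ {A : Set} (xs : List A) {ys} → Unique (xs ++ ys) →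
  Unique xs × Unique ys × Disjoint xs ys
Unique-++⁻ []       ys!          = [] , ys! , λ ()
Unique-++⁻ (x ∷ xs) {ys} (x∉ ∷ xsys!) with Unique-++⁻ xs xsys!
... | xs! , ys! , xs#ys = All.++⁻ˡ xs x∉ ∷ xs! , ys! , disjoint
  where
  disjoint : Disjoint (x ∷ xs) ys
  disjoint (here refl , v∈ys) = All.lookup (All.++⁻ʳ xs x∉) v∈ys refl
  disjoint (there v∈xs , v∈ys) = xs#ys (v∈xs , v∈ys)

Unique-map-filter : ∀ {A B : Set} (f : A → B) {P : Pred A 0ℓ} (P? : Decidable P) →
  ∀ {xs} → Unique (map f xs) → Unique (map f (filter P? xs))
Unique-map-filter f P? fxs! = AllPairs.map⁺ (AllPairs.filter⁺ P? (AllPairs.map⁻ fxs!))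

∈-map-filter : ∀ {A B : Set} (f : A → B) {P : Pred A 0ℓ} (P? : Decidable P) →
  ∀ {xs y} → y ∈ map f (filter P? xs) → y ∈ map f xs
∈-map-filter f P? y∈ with ∈-map⁻ f y∈
... | x , x∈ , refl = ∈-map⁺ f (proj₁ (∈-filter⁻ P? x∈))

count : ∀ {A : Set} {P : Pred A 0ℓ} → Decidable P → List A → ℕ
count P? xs = length (filter P? xs)

module _ {A : Set} {P : Pred A 0ℓ} (P? : Decidable P) where

  count-∷ : ∀ {x} xs → P x → count P? (x ∷ xs) ≡ suc (count P? xs)
  count-∷ xs px = cong length (filter-accept P? px)

  count-∷-reject : ∀ {x} xs → ¬ P x → count P? (x ∷ xs) ≡ count P? xs
  count-∷-reject xs ¬px = cong length (filter-reject P? ¬px)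

  count-++ : ∀ xs ys → count P? (xs ++ ys) ≡ count P? xs + count P? ys
  count-++ xs ys = trans (cong length (filter-++ P? xs ys)) (length-++ (filter P? xs))

  count-map : ∀ {B : Set} (f : B → A) xs → count P? (map f xs) ≡ count (P? ∘ f) xs
  count-map f []       = refl
  count-map f (x ∷ xs) with does (P? (f x))
  ... | true  = cong suc (count-map f xs)
  ... | false = count-map f xs

  ∃-nth : ∀ s xs → s < count P? xs →
    ∃₂ λ ys x → ∃ λ zs → xs ≡ ys ++ x ∷ zs × P x × count P? ys ≡ s
  ∃-nth s (x ∷ xs) s< with P? x
  ∃-nth s (x ∷ xs) s< | no ¬px with ∃-nth s xs s<
  ... | ys , z , zs , refl , pz , eq =
    x ∷ ys , z , zs , refl , pz , trans (count-∷-reject ys ¬px) eq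
  ∃-nth zero    (x ∷ xs) s< | yes px = [] , x , xs , refl , px , refl
  ∃-nth (suc s) (x ∷ xs) (s≤s s<) | yes px with ∃-nth s xs s<
  ... | ys , z , zs , refl , pz , eq =
    x ∷ ys , z , zs , refl , pz , trans (count-∷ ys px) (cong suc eq)

-- Applied with `R` the condition of having source x, this bounds what the exclusion of the edge xy
-- costs in a count.
count-≤-+ : ∀ {A : Set} {P Q R : Pred A 0ℓ}
  (P? : Decidable P) (Q? : Decidable Q) (R? : Decidable R) →
  (∀ {x} → P x → Q x ⊎ R x) → ∀ xs → count P? xs ≤ count Q? xs + count R? xs
count-≤-+ P? Q? R? P⇒Q⊎R [] = z≤n
count-≤-+ P? Q? R? P⇒Q⊎R (x ∷ xs) with count-≤-+ P? Q? R? P⇒Q⊎R xs | P? x | Q? x | R? x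
... | ih | yes px | no ¬qx | no ¬rx = contradiction (P⇒Q⊎R px) [ ¬qx , ¬rx ]′
... | ih | yes px | no ¬qx | yes rx = ≤-trans (s≤s ih) (≤-reflexive (sym (+-suc _ _)))
... | ih | yes px | yes qx | no ¬rx = s≤s ih
... | ih | yes px | yes qx | yes rx = s≤s (≤-trans ih (+-monoʳ-≤ _ (n≤1+n _)))
... | ih | no ¬px | no ¬qx | no ¬rx = ih
... | ih | no ¬px | no ¬qx | yes rx = ≤-trans ih (+-monoʳ-≤ _ (n≤1+n _))
... | ih | no ¬px | yes qx | no ¬rx = m≤n⇒m≤1+n ih
... | ih | no ¬px | yes qx | yes rx = m≤n⇒m≤1+n (≤-trans ih (+-monoʳ-≤ _ (n≤1+n _)))

count-unique-≤1 : ∀ {A B : Set} (f : A → B) (b : B) {xs} (P? : Decidable (λ x → f x ≡ b)) →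
  Unique (map f xs) → count P? xs ≤ 1
count-unique-≤1 f b {[]}     P? _            = z≤n
count-unique-≤1 f b {x ∷ xs} P? (x∉ ∷ xs!) with P? x
... | no  _    = count-unique-≤1 f b P? xs!
... | yes refl = s≤s (≤-reflexive (cong length (filter-none P?
        (All.map (λ fx≢fy fy≡fx → fx≢fy (sym fy≡fx)) (All.map⁻ x∉)))))

-- Sizes of vertex sets given by lists.

∣⁅v⁆∪p∣≤1+∣p∣ : ∀ {n} (v : Fin n) (p : Subset n) → ∣ ⁅ v ⁆ ∪ p ∣ ≤ suc ∣ p ∣
∣⁅v⁆∪p∣≤1+∣p∣ zero    (inside  ∷ p) = s≤s (m≤n⇒m≤1+n (≤-reflexive (cong ∣_∣ (∪-identityˡ p))))
∣⁅v⁆∪p∣≤1+∣p∣ zero    (outside ∷ p) = s≤s (≤-reflexive (cong ∣_∣ (∪-identityˡ p)))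
∣⁅v⁆∪p∣≤1+∣p∣ (suc v) (inside  ∷ p) = s≤s (∣⁅v⁆∪p∣≤1+∣p∣ v p)
∣⁅v⁆∪p∣≤1+∣p∣ (suc v) (outside ∷ p) = ∣⁅v⁆∪p∣≤1+∣p∣ v p

v∉p⇒∣⁅v⁆∪p∣≡1+∣p∣ : ∀ {n} (v : Fin n) (p : Subset n) → v ∉ₛ p → ∣ ⁅ v ⁆ ∪ p ∣ ≡ suc ∣ p ∣
v∉p⇒∣⁅v⁆∪p∣≡1+∣p∣ zero    (inside  ∷ p) v∉p = contradiction Vec.here v∉p
v∉p⇒∣⁅v⁆∪p∣≡1+∣p∣ zero    (outside ∷ p) v∉p = cong suc (cong ∣_∣ (∪-identityˡ p))
v∉p⇒∣⁅v⁆∪p∣≡1+∣p∣ (suc v) (inside  ∷ p) v∉p = cong suc (v∉p⇒∣⁅v⁆∪p∣≡1+∣p∣ v p (v∉p ∘ Vec.there))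
v∉p⇒∣⁅v⁆∪p∣≡1+∣p∣ (suc v) (outside ∷ p) v∉p = v∉p⇒∣⁅v⁆∪p∣≡1+∣p∣ v p (v∉p ∘ Vec.there)

fromList : ∀ {n} → List (Fin n) → Subset n
fromList = foldr (λ v p → ⁅ v ⁆ ∪ p) ⊥

module _ {n : ℕ} where

  ∈-fromList⁺ : ∀ {v : Fin n} {l} → v ∈ l → v ∈ₛ fromList l
  ∈-fromList⁺ (here refl) = x∈p∪q⁺ (inj₁ (x∈⁅x⁆ _))
  ∈-fromList⁺ (there v∈l) = x∈p∪q⁺ (inj₂ (∈-fromList⁺ v∈l))

  ∈-fromList⁻ : ∀ {v : Fin n} l → v ∈ₛ fromList l → v ∈ l
  ∈-fromList⁻ []      v∈ = contradiction v∈ ∉⊥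
  ∈-fromList⁻ (w ∷ l) v∈ with x∈p∪q⁻ ⁅ w ⁆ (fromList l) v∈
  ... | inj₁ v∈⁅w⁆ = here (x∈⁅y⁆⇒x≡y w v∈⁅w⁆)
  ... | inj₂ v∈l   = there (∈-fromList⁻ l v∈l)

  ∣fromList∣≤length : ∀ (l : List (Fin n)) → ∣ fromList l ∣ ≤ length l
  ∣fromList∣≤length []      = ≤-reflexive (∣⊥∣≡0 n)
  ∣fromList∣≤length (v ∷ l) = ≤-trans (∣⁅v⁆∪p∣≤1+∣p∣ v (fromList l)) (s≤s (∣fromList∣≤length l))

  ∣fromList∣≡length : ∀ {l : List (Fin n)} → Unique l → ∣ fromList l ∣ ≡ length l
  ∣fromList∣≡length []                = ∣⊥∣≡0 n
  ∣fromList∣≡length {v ∷ l} (v∉ ∷ l!) = trans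
    (v∉p⇒∣⁅v⁆∪p∣≡1+∣p∣ v (fromList l) (λ v∈ → All.lookup v∉ (∈-fromList⁻ l v∈) refl))
    (cong suc (∣fromList∣≡length l!))

  ∣p∣≤length : ∀ {p : Subset n} {l} → (∀ {v} → v ∈ₛ p → v ∈ l) → ∣ p ∣ ≤ length l
  ∣p∣≤length {l = l} p⊆l = ≤-trans (p⊆q⇒∣p∣≤∣q∣ (∈-fromList⁺ ∘ p⊆l)) (∣fromList∣≤length l)

  -- Pigeonhole: if `l` contained every vertex, the full set would have at most `length l` elements.
  ∃∉ : ∀ (l : List (Fin n)) → length l < n → ∃ (_∉ l)
  ∃∉ l l<n = ¬∀⟶∃¬ n (_∈ l) (λ v → Any.any? (v ≟_) l) λ all∈l →
    <⇒≱ l<n (subst (_≤ length l) (∣⊤∣≡n n) (∣p∣≤length {p = ⊤} (λ {v} _ → all∈l v)))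

-- Walks and bipartite holes

module _ {n : ℕ} {G : Graph n} where
  open Graph G renaming (sym to Adj-sym; irrefl to Adj-irrefl)

  join : ∀ {u v w z} → Walk G u v → Adj v w → Walk G w z → Walk G u z
  join (stop u)     e q = step u e q
  join (step u f p) e q = step u f (join p e q)

  vertices-join : ∀ {u v w z} (p : Walk G u v) (e : Adj v w) (q : Walk G w z) →
    vertices G (join p e q) ≡ vertices G p ++ vertices G q
  vertices-join (stop u)     e q = refl
  vertices-join (step u f p) e q = cong (u ∷_) (vertices-join p e q)

  rev : ∀ {u v} → Walk G u v → Walk G v u
  rev (stop u)     = stop u
  rev (step u e p) = join (rev p) (Adj-sym e) (stop u)

  vertices-rev : ∀ {u v} (p : Walk G u v) → vertices G (rev p) ↭ vertices G p
  vertices-rev (stop u)     = ↭-refl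
  vertices-rev (step u e p) = ↭-trans
    (↭-reflexive (vertices-join (rev p) (Adj-sym e) (stop u)))
    (↭-trans (++⁺ (vertices-rev p) ↭-refl) (↭-sym (∷↭∷ʳ u (vertices G p))))

  -- Each edge is recorded in the direction of travel. Hence the sources run through all vertices
  -- but the last, and the targets through all but the first.
  edges : ∀ {u v} → Walk G u v → List (Fin n × Fin n)
  edges (stop u)         = []
  edges (step u {v} _ p) = (u , v) ∷ edges p

  edges-join : ∀ {u v w z} (p : Walk G u v) (e : Adj v w) (q : Walk G w z) →
    edges (join p e q) ≡ edges p ++ (v , w) ∷ edges q
  edges-join (stop u)         e q = refl
  edges-join (step u {v} f p) e q = cong ((u , v) ∷_) (edges-join p e q)

  swap∈edges-rev : ∀ {u v e} (p : Walk G u v) → e ∈ edges p → swap e ∈ edges (rev p)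
  swap∈edges-rev (step u e p) (here refl) =
    subst (_ ∈_) (sym (edges-join (rev p) _ _)) (∈-insert (edges (rev p)))
  swap∈edges-rev (step u e p) (there e∈p) =
    subst (_ ∈_) (sym (edges-join (rev p) _ _)) (∈-++⁺ˡ (swap∈edges-rev p e∈p))

  vertices≡sources : ∀ {u v} (p : Walk G u v) → vertices G p ≡ map proj₁ (edges p) ∷ʳ v
  vertices≡sources (stop u)     = refl
  vertices≡sources (step u _ p) = cong (u ∷_) (vertices≡sources p)

  vertices≡targets : ∀ {u v} (p : Walk G u v) → vertices G p ≡ u ∷ map proj₂ (edges p)
  vertices≡targets (stop u)     = refl
  vertices≡targets (step u _ p) = cong (u ∷_) (vertices≡targets p)

  start∈ : ∀ {u v} (p : Walk G u v) → u ∈ vertices G p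
  start∈ (stop u)     = here refl
  start∈ (step u _ p) = here refl

  end∈ : ∀ {u v} (p : Walk G u v) → v ∈ vertices G p
  end∈ (stop u)     = here refl
  end∈ (step u _ p) = there (end∈ p)

  closed-path-trivial : ∀ {u} (p : Walk G u u) → IsPath G p → vertices G p ≡ u ∷ []
  closed-path-trivial (stop u)     _        = refl
  closed-path-trivial (step u _ p) (u∉ ∷ _) = contradiction refl (All.lookup u∉ (end∈ p))

  split : ∀ {u v c d} (p : Walk G u v) X {Y} → edges p ≡ X ++ (c , d) ∷ Y →
    Σ (Walk G u c) λ q → Σ (Adj c d) λ e → Σ (Walk G d v) λ r →
      p ≡ join q e r × edges q ≡ X × edges r ≡ Y
  split (step u e p) []      refl = stop u , e , p , refl , refl , refl
  split (step u e p) (x ∷ X) eq with List.∷-injective eq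
  ... | refl , eq′ with split p X eq′
  ...   | q , f , r , refl , refl , refl = step u e q , f , r , refl , refl , refl

  split₂ : ∀ {u v c d c′ d′} (p : Walk G u v) X Y → edges p ≡ X ++ Y →
    (c , d) ∈ X → (c′ , d′) ∈ Y →
    Σ (Walk G u c) λ q → Σ (Adj c d) λ e → Σ (Walk G d c′) λ r →
    Σ (Adj c′ d′) λ e′ → Σ (Walk G d′ v) λ t → p ≡ join q e (join r e′ t)
  split₂ p X Y eq e∈X f∈Y with ∈-∃++ e∈X | ∈-∃++ f∈Y
  ... | X₁ , X₂ , refl | Y₁ , Y₂ , refl
    with split p X₁ (trans eq (++-assoc X₁ _ _))
  ... | q , e , p′ , refl , _ , eq′
    with split p′ (X₂ ++ Y₁) (trans eq′ (sym (++-assoc X₂ _ _)))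
  ... | r , e′ , t , refl , _ , _ = q , e , r , e′ , t , refl

  ∈-neighbours⁻ : ∀ {u v} → v ∈ₛ neighbours G u → Adj u v
  ∈-neighbours⁻ {u} {v} v∈ with adj? u v in eq
  ... | yes a = a
  ... | no ¬a with trans (sym (Vec.[]=⇒lookup v∈)) (trans (Vec.lookup∘tabulate _ v) (cong does eq))
  ...   | ()

  ∈-neighbours⁺ : ∀ {u v} → Adj u v → v ∈ₛ neighbours G u
  ∈-neighbours⁺ {u} {v} a = Vec.lookup⇒[]= v _
    (trans (Vec.lookup∘tabulate _ v) (dec-true (adj? u v) a))

  degree≤count : ∀ u {l} → (∀ v → v ∈ l) → degree G u ≤ count (adj? u) l
  degree≤count u all∈l = ∣p∣≤length λ v∈ → ∈-filter⁺ (adj? u) (all∈l _) (∈-neighbours⁻ v∈)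

  -- The edge hg closes `c` up; taking xy out of the closed walk leaves a walk from y through h and
  -- g round to x.
  rotate : ∀ {g h x y} (c : Walk G g h) → Adj h g → (x , y) ∈ edges c →
    Σ (Walk G y x) λ p → vertices G p ↭ vertices G c
  rotate c hg xy∈ with ∈-∃++ xy∈
  ... | X , _ , eq with split c X eq
  ...   | q , e , r , refl , _ = join r hg q ,
    ↭-trans (↭-reflexive (vertices-join r hg q))
      (↭-trans (++-comm (vertices G r) _) (↭-reflexive (sym (vertices-join q e r))))

  -- Holes have exact sizes, so both lists are cut down to their first `s` and `t` entries. Without
  -- an edge between `S` and `T` these entries would form a hole.
  hole-free⇒edge : ∀ {s t} {S T : List (Fin n)} → ¬ HasBipartiteHole G s t →
    Unique S → Unique T → Disjoint S T → s ≤ length S → t ≤ length T →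
    ∃₂ λ u v → u ∈ S × v ∈ T × Adj u v
  hole-free⇒edge {s} {t} {S} {T} no-hole S! T! S#T s≤ t≤
    with Any.any? (λ u → Any.any? (adj? u) T) S
  ... | yes found with find found
  ...   | u , u∈S , found′ with find found′
  ...     | v , v∈T , uv = u , v , u∈S , v∈T , uv
  hole-free⇒edge {s} {t} {S} {T} no-hole S! T! S#T s≤ t≤ | no none =
    contradiction (fromList (take s S) , fromList (take t T) , hole) no-hole
    where
    ∈-take : ∀ k (l : List (Fin n)) {v} → v ∈ₛ fromList (take k l) → v ∈ l
    ∈-take k l v∈ = subst (_ ∈_) (take++drop≡id k l) (∈-++⁺ˡ (∈-fromList⁻ (take k l) v∈))

    size : ∀ {k} {l : List (Fin n)} → Unique l → k ≤ length l → ∣ fromList (take k l) ∣ ≡ k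
    size {k} {l} l! k≤ = trans (∣fromList∣≡length (Unique.take⁺ k l!))
      (trans (length-take k l) (m≤n⇒m⊓n≡m k≤))

    hole : IsBipartiteHole G s t (fromList (take s S)) (fromList (take t T))
    hole =
      (λ (v , v∈) → let v∈S , v∈T = x∈p∩q⁻ _ _ v∈ in S#T (∈-take s S v∈S , ∈-take t T v∈T)) ,
      size S! s≤ , size T! t≤ ,
      λ u v u∈ v∈ uv → none (lose (∈-take s S u∈) (lose (∈-take t T v∈) uv))

-- Only the vertex list up to order matters, so the two walks may have different ends and lie in
-- different graphs.
IsHamiltonian-resp-↭ : ∀ {n} {G H : Graph n} {u v w z} {p : Walk G u v} {q : Walk H w z} →
  vertices H q ↭ vertices G p → IsHamiltonian G p → IsHamiltonian H q
IsHamiltonian-resp-↭ q↭p (p! , p-all) =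
  Unique-resp-↭ (setoid _) (↭⇒↭ₛ (↭-sym q↭p)) p! , λ w → ∈-resp-↭ (↭-sym q↭p) (p-all w)

-- Removing an added edge

module _ {n : ℕ} {G : Graph n} where
  open Graph G renaming (sym to Adj-sym; irrefl to Adj-irrefl)

  -- The cycle may run through xy in either direction; in one of the two cases the rotated walk has
  -- to be reversed.
  cycle⇒path : ∀ {g h x y} (c : Walk G g h) → Adj h g →
    (x , y) ∈ edges c ⊎ (y , x) ∈ edges c →
    Σ (Walk G x y) λ p → vertices G p ↭ vertices G c
  cycle⇒path c hg (inj₂ yx∈) = rotate c hg yx∈
  cycle⇒path c hg (inj₁ xy∈) with rotate c hg xy∈
  ... | p , p↭c = rev p , ↭-trans (vertices-rev p) p↭c

  module _ {a b x y : Fin n} where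

    vertices-join₃ : ∀ {g c d c′ d′ h} (q : Walk G g c) (e : Adj c d) (r : Walk G d c′)
      (e′ : Adj c′ d′) (t : Walk G d′ h) →
      vertices G (join q e (join r e′ t)) ≡ vertices G q ++ vertices G r ++ vertices G t
    vertices-join₃ q e r e′ t =
      trans (vertices-join q e _) (cong (vertices G q ++_) (vertices-join r e′ t))

    module _ {c d c′ d′ : Fin n} (q : Walk G a c) (e : Adj c d) (r : Walk G d c′)
             (e′ : Adj c′ d′) (t : Walk G d′ b)
             (xy∈ : (x , y) ∈ edges (join q e (join r e′ t))) (c≢x : c ≢ x) (c′≢x : c′ ≢ x)
             where

      private
        -- Neither of the two edges to be deleted has source x, so xy lies on one of the three
        -- remaining segments and survives on the new cycle. The direction in which the cycle passes
        -- it depends on the segment.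
        data Location : Set where
          in-q : (x , y) ∈ edges q → Location
          in-r : (x , y) ∈ edges r → Location
          in-t : (x , y) ∈ edges t → Location

        location : Location
        location with ∈-++⁻ (edges q) (subst (_ ∈_) (edges-join q e _) xy∈)
        ... | inj₁ xy∈q = in-q xy∈q
        ... | inj₂ (here refl) = contradiction refl c≢x
        ... | inj₂ (there xy∈rt) with ∈-++⁻ (edges r) (subst (_ ∈_) (edges-join r e′ t) xy∈rt)
        ...   | inj₁ xy∈r = in-r xy∈r
        ...   | inj₂ (here refl) = contradiction refl c′≢x
        ...   | inj₂ (there xy∈t) = in-t xy∈t

        module _ {g h i j k l : Fin n} (q′ : Walk G g h) (f : Adj h i) (r′ : Walk G i j)
                 (f′ : Adj j k) (t′ : Walk G k l) where

          ∈-join₁ : ∀ {e} → e ∈ edges q′ → e ∈ edges (join q′ f (join r′ f′ t′))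
          ∈-join₁ e∈ = subst (_ ∈_) (sym (edges-join q′ f _)) (∈-++⁺ˡ e∈)

          ∈-join₂ : ∀ {e} → e ∈ edges r′ → e ∈ edges (join q′ f (join r′ f′ t′))
          ∈-join₂ e∈ = subst (_ ∈_) (sym (edges-join q′ f _))
            (∈-++⁺ʳ (edges q′) (there (subst (_ ∈_) (sym (edges-join r′ f′ t′)) (∈-++⁺ˡ e∈))))

          ∈-join₃ : ∀ {e} → e ∈ edges t′ → e ∈ edges (join q′ f (join r′ f′ t′))
          ∈-join₃ e∈ = subst (_ ∈_) (sym (edges-join q′ f _))
            (∈-++⁺ʳ (edges q′) (there (subst (_ ∈_) (sym (edges-join r′ f′ t′))
              (∈-++⁺ʳ (edges r′) (there e∈)))))

      -- The cycle is c ⋯ a, d ⋯ c′, b ⋯ d′, c.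
      parallel-exchange : Adj a d → Adj b c′ → Adj c d′ →
        Σ (Walk G x y) λ p → vertices G p ↭ vertices G (join q e (join r e′ t))
      parallel-exchange ad bc′ cd′ with cycle⇒path
        (join (rev q) ad (join r (Adj-sym bc′) (rev t))) (Adj-sym cd′) (xy-in location)
        where
        xy-in : Location → _
        xy-in (in-q m) = inj₂ (∈-join₁ (rev q) _ r _ (rev t) (swap∈edges-rev q m))
        xy-in (in-r m) = inj₁ (∈-join₂ (rev q) _ r _ (rev t) m)
        xy-in (in-t m) = inj₂ (∈-join₃ (rev q) _ r _ (rev t) (swap∈edges-rev t m))
      ... | p , p↭ = p , ↭-trans p↭
        (↭-trans (↭-reflexive (vertices-join₃ (rev q) ad r _ (rev t)))
        (↭-trans (++⁺ (vertices-rev q) (++⁺ˡ (vertices G r) (vertices-rev t)))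
                 (↭-reflexive (sym (vertices-join₃ q e r e′ t)))))

      -- The cycle is c ⋯ a, d′ ⋯ b, d ⋯ c′, c.
      crossed-exchange : Adj a d′ → Adj b d → Adj c c′ →
        Σ (Walk G x y) λ p → vertices G p ↭ vertices G (join q e (join r e′ t))
      crossed-exchange ad′ bd cc′ with cycle⇒path
        (join (rev q) ad′ (join t bd r)) (Adj-sym cc′) (xy-in location)
        where
        xy-in : Location → _
        xy-in (in-q m) = inj₂ (∈-join₁ (rev q) _ t _ r (swap∈edges-rev q m))
        xy-in (in-r m) = inj₁ (∈-join₃ (rev q) _ t _ r m)
        xy-in (in-t m) = inj₁ (∈-join₂ (rev q) _ t _ r m)
      ... | p , p↭ = p , ↭-trans p↭
        (↭-trans (↭-reflexive (vertices-join₃ (rev q) ad′ t bd r))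
        (↭-trans (++⁺ (vertices-rev q) (++-comm (vertices G t) (vertices G r)))
                 (↭-reflexive (sym (vertices-join₃ q e r e′ t)))))

  -- Counting the neighbours of a and b along Q.

  module _ {s t : ℕ} (no-hole : ¬ HasBipartiteHole G (suc s) (suc t))
           {a b x y : Fin n} (Q : Walk G a b) (Q-ham : IsHamiltonian G Q)
           (xy∈Q : (x , y) ∈ edges Q) (¬ab : ¬ Adj a b)
           (a-deg : suc s + suc t ≤ degree G a) (b-deg : suc s + suc t ≤ degree G b) where

    private
      Edge : Set
      Edge = Fin n × Fin n

      -- Q passes x once, so the condition on the first component excludes just the edge xy.
      A? : Decidable (λ (e : Edge) → proj₁ e ≢ x × Adj a (proj₂ e))
      A? (c , d) = ¬? (c ≟ x) ×-dec adj? a d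

      -- An edge in A followed later on Q by one in B is the configuration of `parallel-exchange`;
      -- an edge in C followed by one in A is that of `crossed-exchange`.
      B? : Decidable (λ (e : Edge) → proj₁ e ≢ x × Adj b (proj₁ e))
      B? (c , d) = ¬? (c ≟ x) ×-dec adj? b c

      C? : Decidable (λ (e : Edge) → proj₁ e ≢ x × Adj b (proj₂ e))
      C? (c , d) = ¬? (c ≟ x) ×-dec adj? b d

      X? : Decidable (λ (e : Edge) → proj₁ e ≡ x)
      X? (c , d) = c ≟ x

      drop-X : (P : Pred Edge 0ℓ) → ∀ {e} → P e → (proj₁ e ≢ x × P e) ⊎ proj₁ e ≡ x
      drop-X P {c , d} p with c ≟ x
      ... | yes c≡x = inj₂ c≡x
      ... | no  c≢x = inj₁ (c≢x , p)

      sources! : Unique (map proj₁ (edges Q))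
      sources! = proj₁ (Unique-++⁻ _ (subst Unique (vertices≡sources Q) (proj₁ Q-ham)))

      ¬loop : ∀ {v} → ¬ Adj v v
      ¬loop = Adj-irrefl refl

      X≤1 : count X? (edges Q) ≤ 1
      X≤1 = count-unique-≤1 proj₁ x X? sources!

      -- Every vertex but a is the target of an edge of Q, and a is not its own neighbour. So the
      -- degree of a is reached by targets, and at most one edge is lost for having source x.
      A-large : suc s + t < count A? (edges Q) + 1
      A-large = begin-strict
        suc s + t                                       <⟨ +-monoʳ-< (suc s) (n<1+n t) ⟩
        suc s + suc t                                   ≤⟨ a-deg ⟩
        degree G a                                      ≤⟨ degree≤count {G = G} a (proj₂ Q-ham) ⟩
        count (adj? a) (vertices G Q)                   ≡⟨ cong (count (adj? a)) (vertices≡targets Q) ⟩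
        count (adj? a) (a ∷ map proj₂ (edges Q))        ≡⟨ count-∷-reject (adj? a) _ ¬loop ⟩
        count (adj? a) (map proj₂ (edges Q))            ≡⟨ count-map (adj? a) proj₂ (edges Q) ⟩
        count (adj? a ∘ proj₂) (edges Q)
          ≤⟨ count-≤-+ (adj? a ∘ proj₂) A? X? (drop-X (Adj a ∘ proj₂)) (edges Q) ⟩
        count A? (edges Q) + count X? (edges Q)         ≤⟨ +-monoʳ-≤ (count A? (edges Q)) X≤1 ⟩
        count A? (edges Q) + 1                          ∎
        where open ≤-Reasoning

      -- The pivot cd is an edge in A that counts on both sides: together with `F` it gives `suc s`
      -- edges in A, together with `E` at least `suc t`. This makes up for the one edge that may be
      -- lost to xy.
      module Pivot {F c d E} (eq : edges Q ≡ F ++ (c , d) ∷ E)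
                   (c∈A : c ≢ x × Adj a d) (F-count : count A? F ≡ s) where

        F∷ʳ : List Edge
        F∷ʳ = F ∷ʳ (c , d)

        eq′ : edges Q ≡ F∷ʳ ++ E
        eq′ = trans eq (sym (++-assoc F _ _))

        A-F∷ʳ : suc s ≤ count A? F∷ʳ
        A-F∷ʳ = ≤-reflexive (sym (trans (count-++ A? F _)
          (trans (cong (count A? F +_) (count-∷ A? [] c∈A))
          (trans (+-comm _ 1) (cong suc F-count)))))

        A-rest : suc t ≤ count A? ((c , d) ∷ E)
        A-rest = +-cancelˡ-< s t _ (s<s⁻¹ (begin-strict
          suc s + t                            <⟨ A-large ⟩
          count A? (edges Q) + 1               ≡⟨ +-comm _ 1 ⟩
          suc (count A? (edges Q))             ≡⟨ cong (suc ∘ count A?) eq ⟩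
          suc (count A? (F ++ (c , d) ∷ E))    ≡⟨ cong suc (count-++ A? F _) ⟩
          suc (count A? F + count A? ((c , d) ∷ E)) ≡⟨ cong (λ k → suc (k + count A? ((c , d) ∷ E))) F-count ⟩
          suc (s + count A? ((c , d) ∷ E))     ∎))
          where open ≤-Reasoning

        -- Cutting the vertices of Q between c and d writes the front part by targets and the back
        -- part by sources, as needed to count the neighbours of b by C on `F` and by B on `E`.
        vertices-split : vertices G Q ≡ (a ∷ map proj₂ F) ++ (map proj₁ E ∷ʳ b)
        vertices-split with split Q F eq
        ... | p , e , r , refl , refl , refl = trans (vertices-join p e r)
          (cong₂ _++_ (vertices≡targets p) (vertices≡sources r))

        -- The same cut, now with sources in front and targets behind; it makes the two sets used in
        -- `parallel` disjoint.
        source-target-split : vertices G Q ≡ map proj₁ F∷ʳ ++ d ∷ map proj₂ E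
        source-target-split with split Q F eq
        ... | p , e , r , refl , refl , refl = trans (vertices-join p e r)
          (cong₂ _++_ (trans (vertices≡sources p) (sym (map-++ proj₁ (edges p) _))) (vertices≡targets r))

        -- In the count of the neighbours of b along `vertices-split`, the ends a and b contribute
        -- nothing, since ab is not an edge and there are no loops. Over `F` and `E` together at
        -- most one edge has source x.
        CB-large : suc s + suc t ≤ (count C? F + count B? E) + 1
        CB-large = begin
          suc s + suc t                                  ≤⟨ b-deg ⟩
          degree G b                                     ≤⟨ degree≤count {G = G} b (proj₂ Q-ham) ⟩
          count b? (vertices G Q)                        ≡⟨ cong (count b?) vertices-split ⟩
          count b? ((a ∷ map proj₂ F) ++ (map proj₁ E ∷ʳ b)) ≡⟨ count-++ b? (a ∷ map proj₂ F) _ ⟩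
          count b? (a ∷ map proj₂ F) + count b? (map proj₁ E ∷ʳ b)
            ≡⟨ cong₂ _+_ (trans (count-∷-reject b? _ (¬ab ∘ Adj-sym)) (count-map b? proj₂ F))
                 (trans (count-++ b? (map proj₁ E) _)
                 (trans (cong (count b? (map proj₁ E) +_) (count-∷-reject b? {b} [] ¬loop))
                 (trans (+-identityʳ _) (count-map b? proj₁ E)))) ⟩
          count (b? ∘ proj₂) F + count (b? ∘ proj₁) E
            ≤⟨ +-mono-≤ (count-≤-+ (b? ∘ proj₂) C? X? (drop-X (Adj b ∘ proj₂)) F)
                        (count-≤-+ (b? ∘ proj₁) B? X? (λ {e} → drop-X (Adj b ∘ proj₁) {e}) E) ⟩
          (count C? F + count X? F) + (count B? E + count X? E)
            ≡⟨ interchange +-commutativeSemigroup (count C? F) (count X? F) (count B? E) (count X? E) ⟩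
          (count C? F + count B? E) + (count X? F + count X? E)
            ≤⟨ +-monoʳ-≤ (count C? F + count B? E) X-FE ⟩
          (count C? F + count B? E) + 1                  ∎
          where
          open ≤-Reasoning
          b? = adj? b
          X-FE : count X? F + count X? E ≤ 1
          X-FE = begin
            -- The count of the pivot is put in, so that the sum runs over all of Q.
            count X? F + count X? E              ≤⟨ +-monoʳ-≤ (count X? F) (m≤n+m _ (count X? ((c , d) ∷ []))) ⟩
            count X? F + (count X? ((c , d) ∷ []) + count X? E) ≡⟨ cong (count X? F +_) (count-++ X? ((c , d) ∷ []) E) ⟨
            count X? F + count X? ((c , d) ∷ E)  ≡⟨ count-++ X? F _ ⟨
            count X? (F ++ (c , d) ∷ E)          ≡⟨ cong (count X?) eq ⟨
            count X? (edges Q)                   ≤⟨ X≤1 ⟩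
            1                                    ∎

        -- Otherwise the two counts would add up to at most s + t, one less than `CB-large` demands.
        C-or-B : suc s ≤ count C? F ⊎ suc t ≤ count B? E
        C-or-B with suc s ≤? count C? F | suc t ≤? count B? E
        ... | yes p | _     = inj₁ p
        ... | no _  | yes q = inj₂ q
        ... | no ¬p | no ¬q = contradiction
          (≤-trans CB-large (≤-trans
            (+-monoˡ-≤ 1 (+-mono-≤ (s≤s⁻¹ (≰⇒> ¬p)) (s≤s⁻¹ (≰⇒> ¬q))))
            (≤-reflexive (+-comm _ 1))))
          (<⇒≱ (≤-reflexive (cong suc (sym (+-suc s t)))))

        -- The sets are the sources of the edges in A up to and including the pivot and the targets
        -- of the edges in B behind it. An edge between them is the chord cd′ of
        -- `parallel-exchange`.
        parallel : suc t ≤ count B? E → Σ (Walk G x y) λ p → vertices G p ↭ vertices G Q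
        parallel B-E with Unique-++⁻ (map proj₁ F∷ʳ) (subst Unique source-target-split (proj₁ Q-ham))
        ... | S! , (_ ∷ T!) , S#T
          with hole-free⇒edge {G = G} no-hole (Unique-map-filter proj₁ A? S!) (Unique-map-filter proj₂ B? T!)
                 (λ (u , v) → S#T (∈-map-filter proj₁ A? u , there (∈-map-filter proj₂ B? v)))
                 (≤-trans A-F∷ʳ (≤-reflexive (sym (length-map proj₁ (filter A? F∷ʳ)))))
                 (≤-trans B-E (≤-reflexive (sym (length-map proj₂ (filter B? E)))))
        ... | _ , _ , u∈ , v∈ , uv with ∈-map⁻ proj₁ u∈ | ∈-map⁻ proj₂ v∈
        ...   | (u , u′) , u∈′ , refl | (v′ , v) , v∈′ , refl
          with ∈-filter⁻ A? {xs = F∷ʳ} u∈′ | ∈-filter⁻ B? {xs = E} v∈′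
        ...     | u∈F , u≢x , au′ | v∈E , v′≢x , bv′ with split₂ Q F∷ʳ E eq′ u∈F v∈E
        ...       | q , e , r , e′ , t , refl =
          parallel-exchange q e r e′ t xy∈Q u≢x v′≢x au′ bv′ uv

        -- Both sets consist of sources: of the edges in C before the pivot, and of the edges in A
        -- from the pivot on. An edge between them is the chord cc′ of `crossed-exchange`.
        crossed : suc s ≤ count C? F → Σ (Walk G x y) λ p → vertices G p ↭ vertices G Q
        crossed C-F with Unique-++⁻ (map proj₁ F)
          (subst Unique (trans (cong (map proj₁) eq) (map-++ proj₁ F _)) sources!)
        ... | S! , T! , S#T
          with hole-free⇒edge {G = G} no-hole (Unique-map-filter proj₁ C? S!) (Unique-map-filter proj₁ A? {(c , d) ∷ E} T!)
                 (λ (u , v) → S#T (∈-map-filter proj₁ C? u , ∈-map-filter proj₁ A? {(c , d) ∷ E} v))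
                 (≤-trans C-F (≤-reflexive (sym (length-map proj₁ (filter C? F)))))
                 (≤-trans A-rest (≤-reflexive (sym (length-map proj₁ (filter A? ((c , d) ∷ E))))))
        ... | _ , _ , u∈ , v∈ , uv with ∈-map⁻ proj₁ u∈ | ∈-map⁻ proj₁ v∈
        ...   | (u , u′) , u∈′ , refl | (v , v′) , v∈′ , refl
          with ∈-filter⁻ C? {xs = F} u∈′ | ∈-filter⁻ A? {xs = (c , d) ∷ E} v∈′
        ...     | u∈F , u≢x , bu′ | v∈E , v≢x , av′ with split₂ Q F ((c , d) ∷ E) eq u∈F v∈E
        ...       | q , e , r , e′ , t , refl =
          crossed-exchange q e r e′ t xy∈Q u≢x v≢x av′ bu′ uv

    exchange : Σ (Walk G x y) λ p → vertices G p ↭ vertices G Q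
    -- Exactly `s` edges in A precede the pivot, so that it completes the first `suc s` of them.
    exchange with ∃-nth A? s (edges Q)
      (≤-trans (s≤s (m≤m+n s t)) (s≤s⁻¹ (≤-trans A-large (≤-reflexive (+-comm _ 1)))))
    ... | F , (c , d) , E , eq , c∈A , F-count =
      [ crossed , parallel ]′ C-or-B
      where open Pivot eq c∈A F-count

-- Graphs with added edges.

Joins : ∀ {n} (u v a b : Fin n) → Set
Joins u v a b = (a ≡ u × b ≡ v) ⊎ (a ≡ v × b ≡ u)

-- The condition `a ≢ b` keeps the graph simple for u = v too, so diagonal pairs may occur in a list
-- of edges to be added.
addEdge : ∀ {n} → Graph n → Fin n → Fin n → Graph n
addEdge G u v = record
  { Adj    = λ a b → Adj a b ⊎ (a ≢ b × Joins u v a b)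
  ; adj?   = λ a b → adj? a b ⊎-dec (¬? (a ≟ b) ×-dec
               (((a ≟ u) ×-dec (b ≟ v)) ⊎-dec ((a ≟ v) ×-dec (b ≟ u))))
  ; sym    = Sum.map Adj-sym λ (a≢b , ab) → ≢-sym a≢b , Sum.swap (Sum.map swap swap ab)
  ; irrefl = λ { refl (inj₁ aa) → irrefl refl aa ; refl (inj₂ (a≢a , _)) → a≢a refl }
  }
  where open Graph G renaming (sym to Adj-sym)

module _ {n : ℕ} (G : Graph n) (u v : Fin n) where

  private
    G⁺ = addEdge G u v

  addEdge-hole-free : ∀ {s t} → ¬ HasBipartiteHole G s t → ¬ HasBipartiteHole G⁺ s t
  addEdge-hole-free no-hole (S , T , S#T , ∣S∣ , ∣T∣ , no-edge) =
    no-hole (S , T , S#T , ∣S∣ , ∣T∣ , λ a b a∈ b∈ ab → no-edge a b a∈ b∈ (inj₁ ab))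

  degree≤degree-addEdge : ∀ w → degree G w ≤ degree G⁺ w
  degree≤degree-addEdge w = p⊆q⇒∣p∣≤∣q∣
    (∈-neighbours⁺ {G = G⁺} ∘ inj₁ ∘ ∈-neighbours⁻ {G = G})

  avoid-addEdge : ∀ {w a b} → w ≡ u ⊎ w ≡ v → (p : Walk G⁺ a b) → w ∉ vertices G⁺ p →
    Σ (Walk G a b) λ q → vertices G q ≡ vertices G⁺ p
  avoid-addEdge w∈ (stop a) w∉ = stop a , refl
  avoid-addEdge w∈ (step a ab p) w∉ with avoid-addEdge w∈ p (w∉ ∘ there)
  avoid-addEdge w∈ (step a (inj₁ ab) p) w∉ | q , eq = step a ab q , cong (a ∷_) eq
  avoid-addEdge (inj₁ refl) (step a (inj₂ (_ , inj₁ (refl , refl))) p) w∉ | _ =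
    contradiction (here refl) w∉
  avoid-addEdge (inj₁ refl) (step a (inj₂ (_ , inj₂ (refl , refl))) p) w∉ | _ =
    contradiction (there (start∈ p)) w∉
  avoid-addEdge (inj₂ refl) (step a (inj₂ (_ , inj₁ (refl , refl))) p) w∉ | _ =
    contradiction (there (start∈ p)) w∉
  avoid-addEdge (inj₂ refl) (step a (inj₂ (_ , inj₂ (refl , refl))) p) w∉ | _ =
    contradiction (here refl) w∉

  -- A path does not return to the vertex from which it takes the new edge. That vertex is u or v,
  -- so by `avoid-addEdge` the rest of the path lies in G.
  cut-addEdge : ∀ {w z} (p : Walk G⁺ w z) → IsPath G⁺ p →
    (Σ (Walk G w z) λ q → vertices G q ≡ vertices G⁺ p) ⊎
    (∃₂ λ a b → Joins u v a b × Σ (Walk G w a) λ q → Σ (Walk G b z) λ r →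
      vertices G⁺ p ≡ vertices G q ++ vertices G r)
  cut-addEdge (stop w) _ = inj₁ (stop w , refl)
  cut-addEdge (step w {a} (inj₂ (_ , wa)) p) p!@(_ ∷ _)
    with avoid-addEdge (Sum.map proj₁ proj₁ wa) p (Unique.Unique[x∷xs]⇒x∉xs p!)
  ... | q , eq = inj₂ (w , a , wa , stop w , q , cong (w ∷_) (sym eq))
  cut-addEdge (step w (inj₁ wa) p) (_ ∷ p!) with cut-addEdge p p!
  ... | inj₁ (q , eq) = inj₁ (step w wa q , cong (w ∷_) eq)
  ... | inj₂ (a , b , ab , q , r , eq) =
    inj₂ (a , b , ab , step w wa q , r , cong (w ∷_) eq)

  -- A path from u to v that takes the new edge from u to v has no other vertices, which is too few;
  -- one that takes it from v to u visits u twice.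
  remove-ends-edge : 2 < n → ∀ (p : Walk G⁺ u v) → IsHamiltonian G⁺ p →
    Σ (Walk G u v) (IsHamiltonian G)
  remove-ends-edge 2<n p p-ham@(p! , p-all) with cut-addEdge p p!
  ... | inj₁ (q , eq) = q , IsHamiltonian-resp-↭ {p = p} (↭-reflexive eq) p-ham
  ... | inj₂ (_ , _ , inj₁ (refl , refl) , q , r , eq)
    with Unique-++⁻ (vertices G q) (subst Unique eq p!) | ∃∉ (u ∷ v ∷ []) 2<n
  ...   | q! , r! , _ | w , w∉ = contradiction (subst (w ∈_) two (p-all w)) w∉
    where
    two : vertices G⁺ p ≡ u ∷ v ∷ []
    two = trans eq (cong₂ _++_ (closed-path-trivial q q!) (closed-path-trivial r r!))
  remove-ends-edge 2<n p p-ham@(p! , p-all) | inj₂ (_ , _ , inj₂ (refl , refl) , q , r , eq) =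
    contradiction (start∈ q , start∈ r)
      (proj₂ (proj₂ (Unique-++⁻ (vertices G q) (subst Unique eq p!))))

  remove-edge : ∀ {s t x y} → ¬ HasBipartiteHole G (suc s) (suc t) → Graph.Adj G x y →
    suc s + suc t ≤ degree G u → suc s + suc t ≤ degree G v →
    Σ (Walk G⁺ x y) (IsHamiltonian G⁺) → Σ (Walk G x y) (IsHamiltonian G)
  remove-edge {s} {t} {x} {y} no-hole xy u-deg v-deg (p , p-ham) with cut-addEdge p (proj₁ p-ham)
  ... | inj₁ (q , eq) = q , IsHamiltonian-resp-↭ {p = p} (↭-reflexive eq) p-ham
  ... | inj₂ (a , b , joins , q , r , eq) with Graph.adj? G a b
  -- A step recorded as new may join vertices that are adjacent in G already; then the path stays as
  -- it is.
  ...   | yes ab = join q ab r , IsHamiltonian-resp-↭ {p = p}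
            (↭-reflexive (trans (vertices-join q ab r) (sym eq))) p-ham
  ...   | no ¬ab = p′ , IsHamiltonian-resp-↭ {p = Q} p′↭Q Q-ham
    where
    -- The path x ⋯ a b ⋯ y becomes a ⋯ x y ⋯ b.
    Q : Walk G a b
    Q = join (rev q) xy (rev r)

    Q-ham : IsHamiltonian G Q
    Q-ham = IsHamiltonian-resp-↭ {p = p} {q = Q}
      (↭-trans (↭-reflexive (vertices-join (rev q) xy (rev r)))
      (↭-trans (++⁺ (vertices-rev q) (vertices-rev r)) (↭-reflexive (sym eq)))) p-ham

    xy∈Q : (x , y) ∈ edges Q
    xy∈Q = subst (_ ∈_) (sym (edges-join (rev q) xy (rev r))) (∈-insert (edges (rev q)))

    degs : ∀ {a b} → Joins u v a b →
      suc s + suc t ≤ degree G a × suc s + suc t ≤ degree G b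
    degs (inj₁ (refl , refl)) = u-deg , v-deg
    degs (inj₂ (refl , refl)) = v-deg , u-deg

    exchanged = exchange no-hole Q Q-ham xy∈Q ¬ab (proj₁ (degs joins)) (proj₂ (degs joins))
    p′ = proj₁ exchanged
    p′↭Q = proj₂ exchanged

addEdges : ∀ {n} → Graph n → List (Fin n × Fin n) → Graph n
addEdges G []             = G
addEdges G ((u , v) ∷ es) = addEdges (addEdge G u v) es

module _ {n : ℕ} where

  addEdges-⊇ : ∀ {G : Graph n} es {u v} → Graph.Adj G u v → Graph.Adj (addEdges G es) u v
  addEdges-⊇ []       uv = uv
  addEdges-⊇ (e ∷ es) uv = addEdges-⊇ es (inj₁ uv)

  addEdges-∈ : ∀ {G : Graph n} {es u v} → u ≢ v → (u , v) ∈ es → Graph.Adj (addEdges G es) u v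
  addEdges-∈ {es = _ ∷ es} u≢v (here refl) = addEdges-⊇ es (inj₂ (u≢v , inj₁ (refl , refl)))
  addEdges-∈               u≢v (there e∈)  = addEdges-∈ u≢v e∈

  -- Adding edges creates no hole and lowers no degree, so every intermediate graph inherits the
  -- hypotheses. The edge added last is removed first.
  remove-edges : ∀ {G : Graph n} {s t x y} es → ¬ HasBipartiteHole G (suc s) (suc t) →
    Graph.Adj G x y →
    All (λ (u , v) → suc s + suc t ≤ degree G u × suc s + suc t ≤ degree G v) es →
    Σ (Walk (addEdges G es) x y) (IsHamiltonian (addEdges G es)) →
    Σ (Walk G x y) (IsHamiltonian G)
  remove-edges []             no-hole xy []                   p = p
  remove-edges {G} ((u , v) ∷ es) no-hole xy ((u-deg , v-deg) ∷ degs) p =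
    remove-edge G u v no-hole xy u-deg v-deg
      (remove-edges es (addEdge-hole-free G u v no-hole) (inj₁ xy)
        (All.map (λ (a-deg , b-deg) → ≤-trans a-deg (degree≤degree-addEdge G u v _) ,
                                      ≤-trans b-deg (degree≤degree-addEdge G u v _)) degs) p)

-- Two cliques

module _ {n : ℕ} {G : Graph n} where
  open Graph G renaming (sym to Adj-sym; irrefl to Adj-irrefl)

  -- For `C` equal to `U` these are the hamiltonian paths; general `C` allows paths through disjoint
  -- sets to be glued together.
  Spans : Pred (Fin n) 0ℓ → ∀ {p q} → Walk G p q → Set
  Spans C w = IsPath G w × (∀ {v} → v ∈ vertices G w → C v) × (∀ {v} → C v → v ∈ vertices G w)

  SpanningPath : Pred (Fin n) 0ℓ → Fin n → Fin n → Set
  SpanningPath C p q = Σ (Walk G p q) (Spans C)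

  spanning-resp : ∀ {C D p q} → (∀ {v} → C v → D v) → (∀ {v} → D v → C v) →
    SpanningPath C p q → SpanningPath D p q
  spanning-resp C⊆D D⊆C (w , w! , w⊆C , C⊆w) = w , w! , C⊆D ∘ w⊆C , C⊆w ∘ D⊆C

  spanning-join : ∀ {C D p q q′ r} → SpanningPath C p q → Adj q q′ → SpanningPath D q′ r →
    (∀ {v} → C v → ¬ D v) → SpanningPath (λ v → C v ⊎ D v) p r
  spanning-join {C} {D} (w , w! , w⊆C , C⊆w) e (z , z! , z⊆D , D⊆z) C#D = join w e z ,
    subst Unique (sym eq) (Unique.++⁺ w! z! λ (v∈w , v∈z) → C#D (w⊆C v∈w) (z⊆D v∈z)) ,
    (λ v∈ → Sum.map w⊆C z⊆D (∈-++⁻ (vertices G w) (subst (_ ∈_) eq v∈))) ,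
    [ (λ c → subst (_ ∈_) (sym eq) (∈-++⁺ˡ (C⊆w c))) ,
      (λ d → subst (_ ∈_) (sym eq) (∈-++⁺ʳ (vertices G w) (D⊆z d))) ]′
    where eq = vertices-join w e z

  spanning-stop : ∀ {C p} → C p → (∀ {v} → C v → v ≡ p) → SpanningPath C p p
  spanning-stop {p = p} c C⊆p = stop p , [] ∷ [] , (λ { (here refl) → c }) , here ∘ C⊆p

  walk-along : ∀ {C : Pred (Fin n) 0ℓ} → (∀ {u v} → C u → C v → u ≢ v → Adj u v) →
    ∀ p l q → Unique (p ∷ l ∷ʳ q) → All C (p ∷ l ∷ʳ q) →
    Σ (Walk G p q) λ w → vertices G w ≡ p ∷ l ∷ʳ q
  walk-along clique p []      q ((p≢q ∷ []) ∷ _) (cp ∷ cq ∷ []) =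
    step p (clique cp cq p≢q) (stop q) , refl
  walk-along clique p (v ∷ l) q ((p≢v ∷ _) ∷ l!) (cp ∷ cv ∷ cl)
    with walk-along clique v l q l! (cv ∷ cl)
  ... | w , eq = step p (clique cp cv p≢v) w , cong (p ∷_) eq

  -- If the ends coincide, the path is a single vertex and `C` must be too, which is what the last
  -- hypothesis grants. Otherwise the inner vertices can be visited in any order.
  clique-path : ∀ {C : Pred (Fin n) 0ℓ} → Decidable C →
    (∀ {u v} → C u → C v → u ≢ v → Adj u v) →
    ∀ {p q} → C p → C q → (p ≡ q → ∀ {v} → C v → v ≡ p) → SpanningPath C p q
  clique-path {C} C? clique {p} {q} cp cq single with p ≟ q
  ... | yes refl = spanning-stop cp (single refl)
  ... | no p≢q = w , subst Unique (sym eq) l! ,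
    (λ v∈ → All.lookup l⊆C (subst (_ ∈_) eq v∈)) , (λ cv → subst (_ ∈_) (sym eq) (C⊆l cv))
    where
    inner? : Decidable (λ v → C v × p ≢ v × v ≢ q)
    inner? v = C? v ×-dec ¬? (p ≟ v) ×-dec ¬? (v ≟ q)

    l : List (Fin n)
    l = filter inner? (allFin n)

    l-inner : ∀ {v} → v ∈ l → C v × p ≢ v × v ≢ q
    l-inner v∈ = proj₂ (∈-filter⁻ inner? {xs = allFin n} v∈)

    l! : Unique (p ∷ l ∷ʳ q)
    l! = All.∷ʳ⁺ (All.tabulate (proj₁ ∘ proj₂ ∘ l-inner)) p≢q ∷
      Unique.++⁺ (Unique.filter⁺ inner? (Unique.allFin⁺ n)) ([] ∷ [])
        λ { (v∈l , here refl) → proj₂ (proj₂ (l-inner v∈l)) refl }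

    l⊆C : All C (p ∷ l ∷ʳ q)
    l⊆C = cp ∷ All.∷ʳ⁺ (All.tabulate (proj₁ ∘ l-inner)) cq

    C⊆l : ∀ {v} → C v → v ∈ p ∷ l ∷ʳ q
    C⊆l {v} cv with p ≟ v | v ≟ q
    ... | yes refl | _        = here refl
    ... | no _     | yes refl = there (∈-insert l)
    ... | no p≢v   | no v≢q   = there (∈-++⁺ˡ (∈-filter⁺ inner? (∈-allFin v) (cv , p≢v , v≢q)))

    along = walk-along clique p l q l! l⊆C
    w = proj₁ along
    eq = proj₂ along

module _ {n : ℕ} {G H : Graph n} (conn : KConnected G 3)
         (G⊆H : ∀ {u v} → Graph.Adj G u v → Graph.Adj H u v) where

  open Graph H using (Adj)

  module _ {P : Pred (Fin n) 0ℓ} (P? : Decidable P) where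

    leaves : ∀ {u v} (w : Walk G u v) → P u → ¬ P v →
      ∃₂ λ a b → P a × ¬ P b × a ∈ vertices G w × b ∈ vertices G w × Graph.Adj G a b
    leaves (stop u)         pu ¬pv = contradiction pu ¬pv
    leaves (step u {v} e w) pu ¬pz with P? v
    ... | no ¬pv = u , v , pu , ¬pv , here refl , there (start∈ w) , e
    ... | yes pv with leaves w pv ¬pz
    ...   | a , b , pa , ¬pb , a∈ , b∈ , ab = a , b , pa , ¬pb , there a∈ , there b∈ , ab

    -- At most two vertices are deleted, so by 3-connectivity a path of G from `p` to `q` remains,
    -- and it leaves `P` somewhere.
    crossing : ∀ l {p q} → length l ≤ 2 → P p → ¬ P q → p ∉ l → q ∉ l →
      ∃₂ λ a b → P a × ¬ P b × a ∉ l × b ∉ l × Adj a b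
    crossing l l≤2 pp ¬pq p∉ q∉
      with proj₂ conn (fromList l) (s≤s (≤-trans (∣fromList∣≤length l) l≤2))
             (p∉ ∘ ∈-fromList⁻ l) (q∉ ∘ ∈-fromList⁻ l)
    ... | w , _ , w∉l with leaves w pp ¬pq
    ...   | a , b , pa , ¬pb , a∈ , b∈ , ab =
      a , b , pa , ¬pb , All.lookup w∉l a∈ ∘ ∈-fromList⁺ , All.lookup w∉l b∈ ∘ ∈-fromList⁺ , G⊆H ab

    two-cliques-from : (∀ {u v} → P u → P v → u ≢ v → Adj u v) →
      (∀ {u v} → ¬ P u → ¬ P v → u ≢ v → Adj u v) →
      ∀ {x y} → P x → x ≢ y → SpanningPath {G = H} U x y
    two-cliques-from P-clique ¬P-clique {x} {y} px x≢y with P? y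
    ... | no ¬py = opposite (any? (λ p → P? p ×-dec ¬? (p ≟ x))) (any? (λ q → ¬? (P? q) ×-dec ¬? (q ≟ y)))
      where
      -- The path is x ⋯ a through `P`, then ab, then b ⋯ y outside `P`. A side may be entered and
      -- left at the same vertex only if it has no other.
      bridge : ∀ {a b} → P a → ¬ P b → Adj a b →
        (x ≡ a → ∀ {v} → P v → v ≡ x) → (b ≡ y → ∀ {v} → ¬ P v → v ≡ b) →
        SpanningPath {G = H} U x y
      bridge pa ¬pb ab single-x single-y = spanning-resp (λ _ → tt) (λ {v} _ → toSum (P? v))
        (spanning-join (clique-path P? P-clique px pa single-x) ab
          (clique-path (¬? ∘ P?) ¬P-clique ¬pb ¬py single-y) (λ p ¬p → ¬p p))

      opposite : Dec (∃ λ p → P p × p ≢ x) → Dec (∃ λ q → ¬ P q × q ≢ y) →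
        SpanningPath {G = H} U x y
      opposite (yes (p , pp , p≢x)) (yes (q , ¬pq , q≢y))
        with crossing (x ∷ y ∷ []) ≤-refl pp ¬pq
          (λ { (here e) → p≢x e ; (there (here refl)) → ¬py pp })
          (λ { (here refl) → ¬pq px ; (there (here e)) → q≢y e })
      ... | a , b , pa , ¬pb , a∉ , b∉ , ab = bridge pa ¬pb ab
        (λ x≡a → contradiction (here (sym x≡a)) a∉) (λ b≡y → contradiction (there (here b≡y)) b∉)
      -- Here y is the only vertex outside `P`, so it is not deleted and the crossing edge ends in
      -- it.
      opposite (yes (p , pp , p≢x)) (no ¬q)
        with crossing (x ∷ []) (s≤s z≤n) pp ¬py
          (λ { (here e) → p≢x e }) (λ { (here e) → x≢y (sym e) })
      ... | a , b , pa , ¬pb , a∉ , b∉ , ab = bridge pa ¬pb ab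
        (λ x≡a → contradiction (here (sym x≡a)) a∉)
        (λ { refl {v} ¬pv → decidable-stable (v ≟ _) (λ v≢ → ¬q (v , ¬pv , v≢)) })
      -- Here `P` contains x alone. More than three vertices leave some `q` other than x and y, and
      -- it lies outside `P`.
      opposite (no ¬p) _ with ∃∉ (x ∷ y ∷ []) (<-trans (n<1+n 2) (proj₁ conn))
      ... | q , q∉ with crossing (y ∷ []) (s≤s z≤n) px
          (λ pq → ¬p (q , pq , q∉ ∘ here)) (λ { (here e) → x≢y e })
          (λ { (here e) → q∉ (there (here e)) })
      ...   | a , b , pa , ¬pb , a∉ , b∉ , ab = bridge pa ¬pb ab
        (λ { refl {v} pv → decidable-stable (v ≟ _) (λ v≢ → ¬p (v , pv , v≢)) })
        (λ b≡y → contradiction (here b≡y) b∉)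
    ... | yes py with any? (¬? ∘ P?)
    ...   | no all-P = spanning-resp (λ _ → tt) (λ {v} _ → decidable-stable (P? v) (λ ¬pv → all-P (v , ¬pv)))
      (clique-path P? P-clique px py (λ x≡y → contradiction x≡y x≢y))
    ...   | yes (z , ¬pz) = detour (any? (λ w → P? w ×-dec ¬? (w ≟ x) ×-dec ¬? (w ≟ y)))
      where
      -- The path runs x ⋯ a through `C`, c ⋯ d outside `P`, and b ⋯ y through `D`, where `C` and
      -- `D` partition `P`.
      sandwich : ∀ {C D : Pred (Fin n) 0ℓ} {a c d b} → SpanningPath {G = H} C x a → Adj a c →
        ¬ P c → ¬ P d → (c ≡ d → ∀ {v} → ¬ P v → v ≡ c) → Adj d b → SpanningPath {G = H} D b y →
        (∀ {v} → C v → P v) → (∀ {v} → D v → P v) → (∀ {v} → C v → ¬ D v) →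
        (∀ {v} → P v → C v ⊎ D v) → SpanningPath {G = H} U x y
      sandwich {C} {D} xa ac ¬pc ¬pd single db by C⊆P D⊆P C#D P⊆C∪D =
        spanning-resp (λ _ → tt) (λ {v} _ → covers v)
          (spanning-join xa ac
            (spanning-join (clique-path (¬? ∘ P?) ¬P-clique ¬pc ¬pd single) db by (λ ¬p d → ¬p (D⊆P d)))
            (λ c → [ (λ ¬p → ¬p (C⊆P c)) , C#D c ]′))
        where
        covers : ∀ v → C v ⊎ ¬ P v ⊎ D v
        covers v with P? v
        ... | no ¬pv = inj₂ (inj₁ ¬pv)
        ... | yes pv = Sum.map₂ inj₂ (P⊆C∪D pv)

      only-xy : ¬ (∃ λ w → P w × w ≢ x × w ≢ y) → ∀ {v} → P v → v ≡ x ⊎ v ≡ y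
      only-xy ¬w {v} pv with v ≟ x | v ≟ y
      ... | yes v≡x | _       = inj₁ v≡x
      ... | no _    | yes v≡y = inj₂ v≡y
      ... | no v≢x  | no v≢y  = contradiction (v , pv , v≢x , v≢y) ¬w

      -- Deleting both ends of ac yields a disjoint crossing edge. If c is the only vertex outside
      -- `P`, just a is deleted, and the detour consists of c alone. As a is not x, the vertex x
      -- remains to start from.
      second-edge : ∀ {a c} → P a → ¬ P c → a ≢ x → Dec (∃ λ v → ¬ P v × v ≢ c) →
        ∃₂ λ b d → P b × ¬ P d × b ≢ a × (c ≡ d → ∀ {v} → ¬ P v → v ≡ c) × Adj b d
      second-edge {a} {c} pa ¬pc a≢x (yes (v , ¬pv , v≢c))
        with crossing (a ∷ c ∷ []) ≤-refl px ¬pv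
               (λ { (here e) → a≢x (sym e) ; (there (here refl)) → ¬pc px })
               (λ { (here refl) → ¬pv pa ; (there (here e)) → v≢c e })
      ... | b , d , pb , ¬pd , b∉ , d∉ , bd =
        b , d , pb , ¬pd , b∉ ∘ here , (λ c≡d → contradiction (there (here (sym c≡d))) d∉) , bd
      second-edge {a} {c} pa ¬pc a≢x (no ¬v)
        with crossing (a ∷ []) (s≤s z≤n) px ¬pc (λ { (here e) → a≢x (sym e) })
               (λ { (here refl) → ¬pc pa })
      ... | b , d , pb , ¬pd , b∉ , _ , bd = b , d , pb , ¬pd , b∉ ∘ here ,
        (λ _ {v} ¬pv → decidable-stable (v ≟ c) (λ v≢c → ¬v (v , ¬pv , v≢c))) , bd

      detour : Dec (∃ λ w → P w × w ≢ x × w ≢ y) → SpanningPath {G = H} U x y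
      detour (no ¬w)
        -- Now `P` consists of x and y. Deleting y forces a = x, and deleting x and c below forces b
        -- = y with d different from c.
        with crossing (y ∷ []) (s≤s z≤n) px ¬pz (λ { (here e) → x≢y e }) (λ { (here refl) → ¬pz py })
      ... | a , c , pa , ¬pc , a∉ , _ , ac
        with ∃∉ (x ∷ y ∷ c ∷ []) (proj₁ conn)
      ...   | w , w∉
        with crossing (x ∷ c ∷ []) ≤-refl py (λ pw → ¬w (w , pw , w∉ ∘ here , w∉ ∘ there ∘ here))
          (λ { (here e) → x≢y (sym e) ; (there (here refl)) → ¬pc py })
          (λ { (here e) → w∉ (here e) ; (there (here e)) → w∉ (there (there (here e))) })
      ...     | b , d , pb , ¬pd , b∉ , d∉ , bd
        with only-xy ¬w pa | only-xy ¬w pb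
      ...       | inj₂ e    | _         = contradiction (here e) a∉
      ...       | inj₁ refl | inj₁ e    = contradiction (here e) b∉
      ...       | inj₁ refl | inj₂ refl = sandwich {_≡ x} {_≡ y}
        (spanning-stop refl id) ac ¬pc ¬pd (λ c≡d → contradiction (there (here (sym c≡d))) d∉)
        (Graph.sym H bd) (spanning-stop refl id)
        (λ { refl → px }) (λ { refl → py }) (λ { refl → x≢y }) (only-xy ¬w)
      detour (yes (w , pw , w≢x , w≢y))
        with crossing (x ∷ y ∷ []) ≤-refl pw ¬pz (λ { (here e) → w≢x e ; (there (here e)) → w≢y e })
               (λ { (here refl) → ¬pz px ; (there (here refl)) → ¬pz py })
      ... | a , c , pa , ¬pc , a∉ , _ , ac
        with second-edge pa ¬pc (a∉ ∘ here) (any? (λ v → ¬? (P? v) ×-dec ¬? (v ≟ c)))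
      ...   | b , d , pb , ¬pd , b≢a , single , bd with b ≟ x
      -- The second edge leaves from x itself, so the detour comes directly after x and returns
      -- through a to the rest of `P`.
      ...     | yes refl = sandwich {_≡ x} {λ v → P v × v ≢ x}
        (spanning-stop refl id) bd ¬pd ¬pc (λ d≡c ¬pv → trans (single (sym d≡c) ¬pv) (sym d≡c))
        (Graph.sym H ac)
        (clique-path (λ v → P? v ×-dec ¬? (v ≟ x)) (λ (pu , _) (pv , _) → P-clique pu pv)
          (pa , a∉ ∘ here) (py , x≢y ∘ sym) (λ a≡y → contradiction (there (here a≡y)) a∉))
        (λ { refl → px }) proj₁ (λ { refl (_ , x≢x) → x≢x refl })
        (λ {v} pv → Sum.map₂ (pv ,_) (toSum (v ≟ x)))
      -- All of `P` except b and y is visited from x to a before the detour; the path then ends with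
      -- b and y, which may coincide.
      ...     | no b≢x = sandwich {λ v → P v × v ≢ b × v ≢ y} {λ v → v ≡ b ⊎ v ≡ y}
        (clique-path (λ v → P? v ×-dec ¬? (v ≟ b) ×-dec ¬? (v ≟ y)) (λ (pu , _) (pv , _) → P-clique pu pv)
          (px , b≢x ∘ sym , x≢y) (pa , b≢a ∘ sym , a∉ ∘ there ∘ here)
          (λ x≡a → contradiction (here (sym x≡a)) a∉))
        ac ¬pc ¬pd single (Graph.sym H bd)
        (clique-path (λ v → (v ≟ b) ⊎-dec (v ≟ y)) (λ b∨y b∨y′ → P-clique (pby b∨y) (pby b∨y′))
          (inj₁ refl) (inj₂ refl) (λ { refl → reduce }))
        proj₁ pby (λ (_ , v≢b , v≢y) → [ v≢b , v≢y ]′)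
        separate
        where
        pby : ∀ {v} → v ≡ b ⊎ v ≡ y → P v
        pby (inj₁ refl) = pb
        pby (inj₂ refl) = py

        separate : ∀ {v} → P v → (P v × v ≢ b × v ≢ y) ⊎ v ≡ b ⊎ v ≡ y
        separate {v} pv with v ≟ b | v ≟ y
        ... | yes v≡b | _       = inj₂ (inj₁ v≡b)
        ... | no _    | yes v≡y = inj₂ (inj₂ v≡y)
        ... | no v≢b  | no v≢y  = inj₁ (pv , v≢b , v≢y)

  two-cliques : ∀ {P : Pred (Fin n) 0ℓ} → Decidable P →
    (∀ {u v} → P u → P v → u ≢ v → Adj u v) →
    (∀ {u v} → ¬ P u → ¬ P v → u ≢ v → Adj u v) →
    ∀ {x y} → x ≢ y → SpanningPath {G = H} U x y
  two-cliques P? P-clique ¬P-clique {x} x≢y with P? x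
  ... | yes px = two-cliques-from P? P-clique ¬P-clique px x≢y
  ... | no ¬px = two-cliques-from (¬? ∘ P?) ¬P-clique
    (λ {u} {v} ¬¬pu ¬¬pv →
      P-clique (decidable-stable (P? u) ¬¬pu) (decidable-stable (P? v) ¬¬pv))
    ¬px x≢y

-- Degree sums and the conclusion.

σ₂≤degree-sum : ∀ {n} (G : Graph n) {u v} → NonAdjacent G u v →
  σ₂ G ≤⁺ Sup.[ degree G u + degree G v ]
σ₂≤degree-sum {n} G {u} {v} uv = min≤v⁺ Sup.⊤⁺ _ (inj₂
  (lose (∈-map⁺ (λ (u , v) → Sup.[ degree G u + degree G v ]) uv∈)
        (TotalOrder.refl ≤⁺-totalOrder)))
  where
  uv∈ : (u , v) ∈ nonAdjacentPairs G
  uv∈ = ∈-filter⁺ (λ (u , v) → nonAdjacent? G u v)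
    (∈-cartesianProduct⁺ (∈-allFin u) (∈-allFin v)) uv

hamiltonian-connected : ∀ {n} (G : Graph n) → KConnected G 3 → ∀ {s t} →
  ¬ HasBipartiteHole G (suc s) (suc t) →
  (∀ {u v} → degree G u < suc s + suc t → degree G v < suc s + suc t → u ≢ v → Graph.Adj G u v) →
  HamiltonianConnected G
hamiltonian-connected {n} G conn {s} {t} no-hole small-clique x y x≢y =
  let p , p-ham = ham-in-G⁺ in remove-ends-edge G x y (<-trans (n<1+n 2) (proj₁ conn)) p p-ham
  where
  -- The edge xy comes in first, so it is present while the edges between big vertices are removed.
  -- Its own ends may be small, and it goes last, by `remove-ends-edge`.
  G⁺ : Graph n
  G⁺ = addEdge G x y

  Big : Pred (Fin n) 0ℓ
  Big v = suc s + suc t ≤ degree G v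

  Big? : Decidable Big
  Big? v = suc s + suc t ≤? degree G v

  both-big? : Decidable (λ (u , v) → Big u × Big v)
  both-big? (u , v) = Big? u ×-dec Big? v

  big-pairs : List (Fin n × Fin n)
  big-pairs = filter both-big? (cartesianProduct (allFin n) (allFin n))

  spanning : SpanningPath {G = addEdges G⁺ big-pairs} U x y
  spanning = two-cliques conn (λ uv → addEdges-⊇ big-pairs (inj₁ uv)) Big?
    (λ {u} {v} u-big v-big u≢v → addEdges-∈ u≢v
      (∈-filter⁺ both-big? (∈-cartesianProduct⁺ (∈-allFin u) (∈-allFin v)) (u-big , v-big)))
    (λ ¬u-big ¬v-big u≢v →
      addEdges-⊇ big-pairs (inj₁ (small-clique (≰⇒> ¬u-big) (≰⇒> ¬v-big) u≢v)))
    x≢y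

  ham-in-G⁺ : Σ (Walk G⁺ x y) (IsHamiltonian G⁺)
  ham-in-G⁺ = remove-edges big-pairs (addEdge-hole-free G x y no-hole)
    (inj₂ (x≢y , inj₁ (refl , refl)))
    (All.tabulate λ e∈ →
      let _ , u-big , v-big = ∈-filter⁻ both-big? {xs = cartesianProduct (allFin n) (allFin n)} e∈ in
      ≤-trans u-big (degree≤degree-addEdge G x y _) , ≤-trans v-big (degree≤degree-addEdge G x y _))
    (let p , p! , _ , p-all = spanning in p , p! , λ w → p-all tt)

mainTheorem3 : ∀ {n : ℕ} (G : Graph n) → KConnected G 3 →
    [ 2 * bipartiteHoleNumber G + 1 ] ≤⁺ σ₂ G → HamiltonianConnected G
mainTheorem3 G conn σ-large with proj₁ (proj₂ (bipartiteHoleNumber-least G))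
... | suc s , suc t , s≤s _ , s≤s _ , s+t≡k+1 , no-hole =
  -- Small vertices have degree at most k, so two nonadjacent ones would have degree sum at most 2k,
  -- below the bound on `σ₂`.
  hamiltonian-connected G conn no-hole λ {u} {v} u-small v-small u≢v →
    decidable-stable (Graph.adj? G u v) λ ¬uv →
      <⇒≱ (degree-sum-small u-small v-small)
        ([≤]-injective _≤_ (TotalOrder.trans ≤⁺-totalOrder σ-large (σ₂≤degree-sum G (u≢v , ¬uv))))
  where
  k = bipartiteHoleNumber G

  degree-sum-small : ∀ {d e} → d < suc s + suc t → e < suc s + suc t → d + e < 2 * k + 1
  degree-sum-small {d} {e} d< e< = begin-strict
    d + e     ≤⟨ +-mono-≤ (bound d<) (bound e<) ⟩
    k + k     ≡⟨ cong (k +_) (+-identityʳ k) ⟨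
    2 * k     <⟨ m<m+n (2 * k) (s≤s z≤n) ⟩
    2 * k + 1 ∎
    where
    open ≤-Reasoning
    bound : ∀ {d} → d < suc s + suc t → d ≤ k
    bound d< = s≤s⁻¹ (≤-trans d< (≤-reflexive (trans s+t≡k+1 (+-comm k 1))))
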